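{- For every integer $k\ge 1$, $|I_k(132,213,231)|$ is equal to the number of odd positive divisors of $k$.
   Context: A permutation of length $n$ is a word $\pi=\pi_1\cdots\pi_n$ containing each of $1,\dots,n$ exactly once. The sum of permutations $\rho=\rho_1\cdots\rho_n$ and $\tau=\tau_1\cdots\tau_m$ is the permutation $\rho\oplus\tau=\rho_1\cdots\rho_n(n+\tau_1)\cdots(n+\tau_m)$ of length $n+m$. A permutation is decomposable if it equals $\rho\oplus\tau$ for some non-empty permutations $\rho,\tau$; a non-empty permutation that is not decomposable is indecomposable. An inversion of $\pi$ is a pair $(i,j)$ with $i<j$ and $\pi_i>\pi_j$. A permutation $\pi$ contains a permutation (pattern) $\tau=\tau_1\cdots\tau_m$ if there are indices $i_1<\dots<i_m$ such that $\pi_{i_1},\dots,\pi_{i_m}$ is order-isomorphic to $\tau_1,\dots,\tau_m$; otherwise $\pi$ avoids $\tau$. $I_k(\tau_1,\dots,\tau_r)$ denotes the (finite) set of all indecomposable permutations, of any length, with exactly $k$ inversions that avoid all of $\tau_1,\dots,\tau_r$. -}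

module Defs where

open import Data.Fin.Base as Fin using (Fin)
import Data.Fin.Properties as Fin
open import Data.List.Base
  using (List; []; _++_; allFin; cartesianProduct; filter; length; lookup; map; upTo)
open import Data.List.Membership.Propositional using (_∈_)
open import Data.List.Relation.Binary.Permutation.Propositional using (_↭_)
open import Data.List.Relation.Unary.All using (All)
open import Data.List.Relation.Unary.Unique.Propositional using (Unique)
open import Data.Nat.Base using (ℕ; suc; _+_; _<_)
open import Data.Nat.Divisibility using (_∣?_)
import Data.Nat.Properties as ℕ
open import Data.Product.Base using (_×_; _,_; Σ-syntax; ∃-syntax)
open import Function.Bundles using (_⇔_)
open import Level using (Level; _⊔_)
open import Relation.Binary.PropositionalEquality using (_≡_; _≢_)
open import Relation.Nullary using (Dec; ¬_)
open import Relation.Nullary.Decidable using (_×-dec_; ¬?)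
open import Relation.Unary using (Pred)

private
  variable
    a p : Level

-- Permutations are words over ℕ with values 1, …, n; positions are
-- elements of Fin n and hence start at 0.

Word : Set
Word = List ℕ

range : ℕ → List ℕ
range n = map suc (upTo n)

IsPermutation : Word → Set
IsPermutation π = π ↭ range (length π)

infixr 5 _⊕_

_⊕_ : Word → Word → Word
ρ ⊕ τ = ρ ++ map (length ρ +_) τ

Decomposable : Word → Set
Decomposable π =
  ∃[ ρ ] ∃[ τ ] IsPermutation ρ × IsPermutation τ × ρ ≢ [] × τ ≢ [] × π ≡ ρ ⊕ τ

Indecomposable : Word → Set
Indecomposable π = π ≢ [] × ¬ Decomposable π

Inversion : (π : Word) → Fin (length π) × Fin (length π) → Set
Inversion π (i , j) = i Fin.< j × lookup π j < lookup π i

inversion? : (π : Word) (ij : Fin (length π) × Fin (length π)) → Dec (Inversion π ij)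
inversion? π (i , j) = (i Fin.<? j) ×-dec (lookup π j ℕ.<? lookup π i)

inversions : Word → ℕ
inversions π =
  length (filter (inversion? π) (cartesianProduct (allFin (length π)) (allFin (length π))))

Contains : Word → Word → Set
Contains π τ =
  Σ[ f ∈ (Fin (length τ) → Fin (length π)) ]
    (∀ {i j} → i Fin.< j → f i Fin.< f j) ×
    (∀ i j → lookup τ i < lookup τ j ⇔ lookup π (f i) < lookup π (f j))

Avoids : Word → Word → Set
Avoids π τ = ¬ Contains π τ

I : ℕ → List Word → Word → Set
I k τs π =
  IsPermutation π × Indecomposable π × inversions π ≡ k × All (Avoids π) τs

HasCardinality : {A : Set a} → Pred A p → ℕ → Set (a ⊔ p)
HasCardinality P n =
  ∃[ xs ] Unique xs × (∀ x → x ∈ xs ⇔ P x) × length xs ≡ n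

-- For k ≥ 1 every positive divisor of k lies in range k.
oddDivisors : ℕ → List ℕ
oddDivisors k = filter (λ d → (d ∣? k) ×-dec ¬? (2 ∣? d)) (range k)

{-# OPTIONS --safe #-}
module Submission where

-- The indecomposable permutations with k ≥ 1 inversions that avoid 132, 213
-- and 231 are exactly the words
--
--   (m+j) (m+j-1) … (m+1) 1 2 … m      with j, m ≥ 1
--
-- having k inversions (`falling j m`).  Indeed, in an avoiding permutation of
-- length n that does not begin with n, the letter n must come last, since
-- otherwise the first letter, n and the last letter form 132 or 231; and then
-- a descent before n would give 213, so the permutation is increasing.
-- Stripping leading maxima thus leads to the displayed shape
-- (`avoiding⇒falling`).  For j ≥ 1 such a word is indecomposable because it
-- begins with its largest letter.
--
-- Replacing m by m + 1, the word `falling j (suc m)` satisfies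
-- 2 · inversions = j (j + 2m + 1) (`inversions-falling`).  The two factors on
-- the right have opposite parity.  So the words with k inversions correspond
-- to the factorisations 2k = d · e with d odd and e even: the smaller of d, e
-- is j, and their difference is 2m + 1 (`Split`).  Such a factorisation is
-- determined by d, which ranges over the odd divisors of k.

open import Defs
open import Data.Fin.Base as Fin using (Fin; zero; suc)
open import Data.List.Base
  using ( List; []; _∷_; [_]; _++_; allFin; cartesianProduct; filter; length
        ; lookup; map; upTo)
open import Data.List.Membership.Propositional using (_∈_)
open import Data.List.Membership.Propositional.Properties
  using ( ∈-∃++; ∈-filter⁺; ∈-filter⁻; ∈-lookup; ∈-map⁺; ∈-map⁻; ∈-upTo⁺; ∈-upTo⁻)
open import Data.List.Properties
  using ( ∷-injective; ∷-injectiveʳ; filter-++; filter-all; filter-none; filter-reject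
        ; length-++; length-map; map-∘; length-upTo; map-++; map-tabulate; tabulate-lookup
        ; upTo-∷ʳ)
open import Data.List.Relation.Binary.Permutation.Propositional
  using (_↭_; ↭-refl; ↭-reflexive; ↭-sym; ↭-trans; prep; ↭⇒↭ₛ)
open import Data.List.Relation.Binary.Permutation.Propositional.Properties
  using (All-resp-↭; ∈-resp-↭; drop-∷; ∷↭∷ʳ)
import Data.List.Relation.Binary.Permutation.Setoid.Properties as Permutationₛ
open import Data.List.Relation.Binary.Pointwise using (Pointwise-≡⇒≡)
open import Data.List.Relation.Binary.Sublist.Propositional
  using (_⊆_; []; _∷_; _∷ʳ_; minimum; ⊆-refl; from∈; to∈)
open import Data.List.Relation.Binary.Sublist.Propositional.Properties
  using (All-resp-⊆; ++⁺)
open import Data.List.Relation.Unary.All as All using (All; []; _∷_)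
import Data.List.Relation.Unary.All.Properties as All
open import Data.List.Relation.Unary.AllPairs as AllPairs using (AllPairs; []; _∷_)
import Data.List.Relation.Unary.AllPairs.Properties as AllPairs
open import Data.List.Relation.Unary.Any using (here; there)
open import Data.List.Relation.Unary.Sorted.TotalOrder.Properties
  using (AllPairs⇒Sorted; ↗↭↗⇒≋)
open import Data.List.Relation.Unary.Unique.Propositional using (Unique)
import Data.List.Relation.Unary.Unique.Propositional.Properties as Unique
open import Data.Nat.Base
  using (ℕ; zero; suc; _+_; _*_; _/_; _≤_; _<_; _⊓_; ∣_-_∣; ⌊_/2⌋; z≤n; s≤s; z<s; s<s; s<s⁻¹; >-nonZero)
open import Data.Nat.Divisibility using (_∣_; _∣?_; divides; ∣⇒≤)
open import Data.Nat.DivMod using (m*n/n≡m)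
open import Data.Nat.Properties
open import Data.Nat.Tactic.RingSolver using (solve-∀)
open import Data.Product.Base using (_×_; _,_; ∃-syntax; ∃₂; proj₁; proj₂)
open import Data.Sum.Base using (_⊎_; inj₁; inj₂)
open import Function.Base using (_∘_; id)
open import Function.Bundles using (_⇔_; mk⇔; Equivalence)
open import Level using (Level)
open import Relation.Binary.Core using (Rel)
open import Relation.Binary.Definitions using (tri<; tri≈; tri>)
open import Relation.Binary.PropositionalEquality hiding ([_])
open import Relation.Nullary using (¬_; yes; no; contradiction)
open import Relation.Nullary.Decidable using (_×-dec_; ¬?)
open import Relation.Unary using (Pred; Decidable)

private
  variable
    a b p q r : Level
    A : Set a
    B : Set b
    x y z u v w : ℕ
    π σ τ : Word

-- Lists and sublists

unique-map : {P : Pred A p} {f : A → B} {xs : List A} →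
             (∀ {x y} → P x → P y → f x ≡ f y → x ≡ y) →
             All P xs → Unique xs → Unique (map f xs)
unique-map inj []         []           = []
unique-map inj (px ∷ pxs) (x∉xs ∷ xs!) =
  All.map⁺ (All.zipWith (λ (py , x≢y) → x≢y ∘ inj px py) (pxs , x∉xs)) ∷
  unique-map inj pxs xs!

length-filter-map : {P : Pred B p} {Q : Pred A q} (P? : Decidable P) (Q? : Decidable Q)
                    {f : A → B} → (∀ x → P (f x) ⇔ Q x) → ∀ xs →
                    length (filter P? (map f xs)) ≡ length (filter Q? xs)
length-filter-map P? Q?     P⇔Q []       = refl
length-filter-map P? Q? {f} P⇔Q (x ∷ xs) with P? (f x) | Q? x
... | yes _  | yes _  = cong suc (length-filter-map P? Q? P⇔Q xs)
... | no  _  | no  _  = length-filter-map P? Q? P⇔Q xs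
... | yes Pf | no  ¬Q = contradiction (Equivalence.to (P⇔Q x) Pf) ¬Q
... | no ¬Pf | yes Q  = contradiction (Equivalence.from (P⇔Q x) Q) ¬Pf

allPairs⁺ : {R : Rel A r} {xs : List A} →
            (∀ {x y} → x ∷ y ∷ [] ⊆ xs → R x y) → AllPairs R xs
allPairs⁺ {xs = []}     _ = []
allPairs⁺ {xs = x ∷ xs} R =
  All.tabulate (λ y∈xs → R (refl ∷ from∈ y∈xs)) ∷ allPairs⁺ (λ s → R (x ∷ʳ s))

allPairs⁻ : {R : Rel A r} {xs : List A} {x y : A} →
            AllPairs R xs → x ∷ y ∷ [] ⊆ xs → R x y
allPairs⁻ (_  ∷ pxs) (_ ∷ʳ s)   = allPairs⁻ pxs s
allPairs⁻ (px ∷ _)   (refl ∷ s) = All.head (All-resp-⊆ s px)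

lookup-mono-< : AllPairs _<_ π → ∀ {i j} → i Fin.< j → lookup π i < lookup π j
lookup-mono-< {π = _ ∷ π} (px ∷ _) {zero}  {suc j} _         = All.lookup px (∈-lookup j)
lookup-mono-< {π = _ ∷ _} (_ ∷ ps) {suc i} {suc j} (s≤s i<j) = lookup-mono-< ps i<j

-- The words 1 2 … n

length-range : ∀ n → length (range n) ≡ n
length-range n = trans (length-map suc (upTo n)) (length-upTo n)

range-∷ʳ : ∀ n → range n ++ [ suc n ] ≡ range (suc n)
range-∷ʳ n = trans (sym (map-++ suc (upTo n) [ n ])) (cong (map suc) (upTo-∷ʳ n))

range-increasing : ∀ n → AllPairs _<_ (range n)
range-increasing n =
  AllPairs.map⁺ (AllPairs.applyUpTo⁺₁ id n (λ i<j _ → s≤s i<j))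

∈-range⁺ : ∀ {n} → 1 ≤ x → x ≤ n → x ∈ range n
∈-range⁺ (s≤s _) x≤n = ∈-map⁺ suc (∈-upTo⁺ x≤n)

∈-range⁻ : ∀ {n} → x ∈ range n → x ≤ n
∈-range⁻ x∈range with _ , i∈upTo , refl ← ∈-map⁻ suc x∈range = ∈-upTo⁻ i∈upTo

module _ {n} (π↭range : π ↭ range n) where

  letters≤ : All (_≤ n) π
  letters≤ = All-resp-↭ (↭-sym π↭range) (All.tabulate ∈-range⁻)

  letters-unique : Unique π
  letters-unique = Permutationₛ.Unique-resp-↭ (setoid ℕ) (↭⇒↭ₛ (↭-sym π↭range))
    (AllPairs.map <⇒≢ (range-increasing n))

  increasing⇒range : AllPairs _<_ π → π ≡ range n
  increasing⇒range π↗ = Pointwise-≡⇒≡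
    (↗↭↗⇒≋ ≤-totalOrder (sorted π↗) (sorted (range-increasing n)) (↭⇒↭ₛ π↭range))
    where
    sorted : ∀ {σ} → AllPairs _<_ σ → _
    sorted = AllPairs⇒Sorted ≤-totalOrder ∘ AllPairs.map <⇒≤

-- Counting inversions

-- The inversions of x ∷ π are those of π together with the pairs formed by x
-- and a smaller letter of π.
inversions-∷ : ∀ x π →
  inversions (x ∷ π) ≡ length (filter (_<? x) π) + inversions π
inversions-∷ x π = begin
  length (filter inv? (cartesianProduct (allFin (suc n)) (allFin (suc n))))
    ≡⟨ cong (λ is → length (filter inv? (cartesianProduct (zero ∷ is) (zero ∷ is))))
            (sym (map-tabulate id suc)) ⟩
  length (filter inv? (map (zero ,_) (zero ∷ is⁺) ++ cartesianProduct is⁺ (zero ∷ is⁺)))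
    ≡⟨ length-filter-++ inv? (map (zero ,_) (zero ∷ is⁺)) ⟩
  length (filter inv? (map (zero ,_) (zero ∷ is⁺))) +
  length (filter inv? (cartesianProduct is⁺ (zero ∷ is⁺)))
    ≡⟨ cong₂ _+_ firstRow (laterRows (allFin n)) ⟩
  length (filter (_<? x) π) + inversions π ∎
  where
  open ≡-Reasoning
  n = length π
  inv? = inversion? (x ∷ π)
  is⁺ = map suc (allFin n)

  length-filter-++ : ∀ {c} {C : Set c} {P : Pred C p} (P? : Decidable P) xs {ys} →
    length (filter P? (xs ++ ys)) ≡ length (filter P? xs) + length (filter P? ys)
  length-filter-++ P? xs {ys} =
    trans (cong length (filter-++ P? xs ys)) (length-++ (filter P? xs))

  firstRow : length (filter inv? (map (zero ,_) (zero ∷ is⁺))) ≡ length (filter (_<? x) π)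
  firstRow = begin
    length (filter inv? (map (zero ,_) (zero ∷ is⁺)))
      ≡⟨ cong length (filter-reject inv? {x = zero , zero} {xs = map (zero ,_) is⁺} λ ()) ⟩
    length (filter inv? (map (zero ,_) is⁺))
      ≡⟨ cong (length ∘ filter inv?) (map-∘ (allFin n)) ⟨
    length (filter inv? (map (λ i → zero , suc i) (allFin n)))
      ≡⟨ length-filter-map inv? (λ i → lookup π i <? x)
                           (λ _ → mk⇔ proj₂ (s≤s z≤n ,_)) (allFin n) ⟩
    length (filter (λ i → lookup π i <? x) (allFin n))
      ≡⟨ length-filter-map (_<? x) _ (λ _ → mk⇔ id id) (allFin n) ⟨
    length (filter (_<? x) (map (lookup π) (allFin n)))
      ≡⟨ cong (length ∘ filter (_<? x))
              (trans (map-tabulate id (lookup π)) (tabulate-lookup π)) ⟩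
    length (filter (_<? x) π) ∎

  laterRow : ∀ i → length (filter inv? (map (suc i ,_) (zero ∷ is⁺))) ≡
                   length (filter (inversion? π) (map (i ,_) (allFin n)))
  laterRow i = begin
    length (filter inv? (map (suc i ,_) (zero ∷ is⁺)))
      ≡⟨ cong length (filter-reject inv? {x = suc i , zero} {xs = map (suc i ,_) is⁺} λ ()) ⟩
    length (filter inv? (map (suc i ,_) is⁺))
      ≡⟨ cong (length ∘ filter inv?) (map-∘ (allFin n)) ⟨
    length (filter inv? (map (λ j → suc i , suc j) (allFin n)))
      ≡⟨ length-filter-map inv? (λ j → inversion? π (i , j))
           (λ _ → mk⇔ (λ (i<j , inv) → s<s⁻¹ i<j , inv) (λ (i<j , inv) → s<s i<j , inv))
           (allFin n) ⟩
    length (filter (λ j → inversion? π (i , j)) (allFin n))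
      ≡⟨ length-filter-map (inversion? π) _ (λ _ → mk⇔ id id) (allFin n) ⟨
    length (filter (inversion? π) (map (i ,_) (allFin n))) ∎

  laterRows : ∀ is → length (filter inv? (cartesianProduct (map suc is) (zero ∷ is⁺))) ≡
                     length (filter (inversion? π) (cartesianProduct is (allFin n)))
  laterRows []       = refl
  laterRows (i ∷ is) = begin
    length (filter inv? (cartesianProduct (map suc (i ∷ is)) (zero ∷ is⁺)))
      ≡⟨ length-filter-++ inv? (map (suc i ,_) (zero ∷ is⁺)) ⟩
    length (filter inv? (map (suc i ,_) (zero ∷ is⁺))) +
    length (filter inv? (cartesianProduct (map suc is) (zero ∷ is⁺)))
      ≡⟨ cong₂ _+_ (laterRow i) (laterRows is) ⟩
    length (filter (inversion? π) (map (i ,_) (allFin n))) +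
    length (filter (inversion? π) (cartesianProduct is (allFin n)))
      ≡⟨ length-filter-++ (inversion? π) (map (i ,_) (allFin n)) ⟨
    length (filter (inversion? π) (cartesianProduct (i ∷ is) (allFin n))) ∎

inversions-increasing : AllPairs _<_ π → inversions π ≡ 0
inversions-increasing []                         = refl
inversions-increasing {π = x ∷ π} (x<π ∷ π↗) = begin
  inversions (x ∷ π)                           ≡⟨ inversions-∷ x π ⟩
  length (filter (_<? x) π) + inversions π
    ≡⟨ cong₂ _+_ (cong length (filter-none (_<? x) (All.map <⇒≯ x<π)))
                 (inversions-increasing π↗) ⟩
  0                                            ∎
  where open ≡-Reasoning

-- Pattern containment

-- A sublist of π as a strictly increasing choice of positions of π.
embed : σ ⊆ π → Fin (length σ) → Fin (length π)
embed (_ ∷ʳ s) i       = suc (embed s i)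
embed (_ ∷ s)  zero    = zero
embed (_ ∷ s)  (suc i) = suc (embed s i)

embed-mono-< : (s : σ ⊆ π) → ∀ {i j} → i Fin.< j → embed s i Fin.< embed s j
embed-mono-< (_ ∷ʳ s) i<j                        = s<s (embed-mono-< s i<j)
embed-mono-< (_ ∷ s) {zero}  {suc j} _           = z<s
embed-mono-< (_ ∷ s) {suc i} {suc j} (s≤s i<j)   = s<s (embed-mono-< s i<j)

lookup-embed : (s : σ ⊆ π) → ∀ i → lookup π (embed s i) ≡ lookup σ i
lookup-embed (_ ∷ʳ s)   i       = lookup-embed s i
lookup-embed (refl ∷ s) zero    = refl
lookup-embed (_ ∷ s)    (suc i) = lookup-embed s i

contains-⊆ : σ ⊆ π → Contains σ τ → Contains π τ
contains-⊆ {σ} {π} {τ} s (f , f-mono , f-iso) =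
  embed s ∘ f , embed-mono-< s ∘ f-mono , iso
  where
  iso : ∀ i j → lookup τ i < lookup τ j ⇔
                lookup π (embed s (f i)) < lookup π (embed s (f j))
  iso i j rewrite lookup-embed s (f i) | lookup-embed s (f j) = f-iso i j

avoids-⊆ : σ ⊆ π → Avoids π τ → Avoids σ τ
avoids-⊆ {τ = τ} s π-avoids = π-avoids ∘ contains-⊆ {τ = τ} s

-- The letters x, y are in the same strict relative order as u, v.
SameOrder : (x y u v : ℕ) → Set
SameOrder x y u v = (x < y × u < v) ⊎ (y < x × v < u)

sameOrder⇒⇔ : SameOrder x y u v → x < y ⇔ u < v
sameOrder⇒⇔ (inj₁ (x<y , u<v)) = mk⇔ (λ _ → u<v) (λ _ → x<y)
sameOrder⇒⇔ (inj₂ (y<x , v<u)) =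
  mk⇔ (λ x<y → contradiction x<y (<⇒≯ y<x)) (λ u<v → contradiction u<v (<⇒≯ v<u))

sameOrder-sym : SameOrder x y u v → SameOrder y x v u
sameOrder-sym (inj₁ lt) = inj₂ lt
sameOrder-sym (inj₂ gt) = inj₁ gt

-- An order isomorphism between words of length three need only be checked on
-- the three pairs of positions i < j.
contains₃ : SameOrder x y u v → SameOrder x z u w → SameOrder y z v w →
            u ∷ v ∷ w ∷ [] ⊆ π → Contains π (x ∷ y ∷ z ∷ [])
contains₃ {x} {y} {u} {v} {z} {w} xy xz yz s = contains-⊆ s (id , id , iso)
  where
  equal : ∀ {a b} → a < a ⇔ b < b
  equal = mk⇔ (λ a<a → contradiction a<a (<-irrefl refl))
              (λ b<b → contradiction b<b (<-irrefl refl))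

  iso : ∀ i j → lookup (x ∷ y ∷ z ∷ []) i < lookup (x ∷ y ∷ z ∷ []) j ⇔
                lookup (u ∷ v ∷ w ∷ []) i < lookup (u ∷ v ∷ w ∷ []) j
  iso zero             zero             = equal
  iso zero             (suc zero)       = sameOrder⇒⇔ xy
  iso zero             (suc (suc zero)) = sameOrder⇒⇔ xz
  iso (suc zero)       zero             = sameOrder⇒⇔ (sameOrder-sym xy)
  iso (suc zero)       (suc zero)       = equal
  iso (suc zero)       (suc (suc zero)) = sameOrder⇒⇔ yz
  iso (suc (suc zero)) zero             = sameOrder⇒⇔ (sameOrder-sym xz)
  iso (suc (suc zero)) (suc zero)       = sameOrder⇒⇔ (sameOrder-sym yz)
  iso (suc (suc zero)) (suc (suc zero)) = equal

132⇒contains : u < w → w < v → u ∷ v ∷ w ∷ [] ⊆ π → Contains π (1 ∷ 3 ∷ 2 ∷ [])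
132⇒contains u<w w<v = contains₃
  (inj₁ (s≤s (s≤s z≤n) , <-trans u<w w<v)) (inj₁ (≤-refl , u<w)) (inj₂ (≤-refl , w<v))

213⇒contains : v < u → u < w → u ∷ v ∷ w ∷ [] ⊆ π → Contains π (2 ∷ 1 ∷ 3 ∷ [])
213⇒contains v<u u<w = contains₃
  (inj₂ (≤-refl , v<u)) (inj₁ (≤-refl , u<w)) (inj₁ (s≤s (s≤s z≤n) , <-trans v<u u<w))

231⇒contains : w < u → u < v → u ∷ v ∷ w ∷ [] ⊆ π → Contains π (2 ∷ 3 ∷ 1 ∷ [])
231⇒contains w<u u<v = contains₃
  (inj₁ (≤-refl , u<v)) (inj₂ (≤-refl , w<u)) (inj₂ (s≤s (s≤s z≤n) , <-trans w<u u<v))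

-- A letter exceeding all letters of π can only play the role of a leading
-- maximum in an occurrence within x ∷ π.
avoids-∷ : (i : Fin (length τ)) → y < lookup τ i → All (_< x) π →
           Avoids π (y ∷ τ) → Avoids (x ∷ π) (y ∷ τ)
avoids-∷ {τ} {y} {x} {π} i y<τᵢ π<x π-avoids (f , f-mono , f-iso) =
  π-avoids (g , g-mono , g-iso)
  where
  f₀≢0 : f zero ≢ zero
  f₀≢0 f₀≡0 with f (suc i) | f-mono {zero} {suc i} z<s
                | Equivalence.to (f-iso zero (suc i)) y<τᵢ
  ... | zero  | f₀<0 | _    = contradiction f₀<0 λ ()
  ... | suc j | _    | x<πⱼ rewrite f₀≡0 =
    <-asym x<πⱼ (All.lookup π<x (∈-lookup j))

  f-suc : ∀ k → ∃[ j ] f k ≡ suc j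
  f-suc k with f k in fₖ
  ... | suc j = j , refl
  f-suc zero    | zero = contradiction fₖ f₀≢0
  f-suc (suc k) | zero =
    contradiction (subst (f zero Fin.<_) fₖ (f-mono {zero} {suc k} z<s)) λ ()

  g : Fin (length (y ∷ τ)) → Fin (length π)
  g = proj₁ ∘ f-suc

  g-mono : ∀ {k l} → k Fin.< l → g k Fin.< g l
  g-mono {k} {l} k<l =
    s<s⁻¹ (subst₂ Fin._<_ (proj₂ (f-suc k)) (proj₂ (f-suc l)) (f-mono k<l))

  g-iso : ∀ k l → lookup (y ∷ τ) k < lookup (y ∷ τ) l ⇔ lookup π (g k) < lookup π (g l)
  g-iso k l = subst₂ (λ m n → lookup (y ∷ τ) k < lookup (y ∷ τ) l ⇔
                              lookup (x ∷ π) m < lookup (x ∷ π) n)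
                     (proj₂ (f-suc k)) (proj₂ (f-suc l)) (f-iso k l)

avoids-increasing : ∀ {i j} → i Fin.< j → lookup τ j < lookup τ i →
                    AllPairs _<_ π → Avoids π τ
avoids-increasing {i = i} {j} i<j τⱼ<τᵢ π↗ (f , f-mono , f-iso) =
  <-asym (lookup-mono-< π↗ (f-mono i<j)) (Equivalence.to (f-iso j i) τⱼ<τᵢ)

-- Words that decrease from the maximum and then increase from 1

-- The word (m+j) (m+j-1) … (m+1) 1 2 … m.
falling : ℕ → ℕ → Word
falling zero    m = range m
falling (suc j) m = suc (j + m) ∷ falling j m

length-falling : ∀ j m → length (falling j m) ≡ j + m
length-falling zero    m = length-range m
length-falling (suc j) m = cong suc (length-falling j m)

max∷range↭range : ∀ n → suc n ∷ range n ↭ range (suc n)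
max∷range↭range n = ↭-trans (∷↭∷ʳ (suc n) (range n)) (↭-reflexive (range-∷ʳ n))

falling↭range : ∀ j m → falling j m ↭ range (j + m)
falling↭range zero    m = ↭-refl
falling↭range (suc j) m =
  ↭-trans (prep (suc (j + m)) (falling↭range j m)) (max∷range↭range (j + m))

falling-isPermutation : ∀ j m → IsPermutation (falling j m)
falling-isPermutation j m =
  subst (λ n → falling j m ↭ range n) (sym (length-falling j m)) (falling↭range j m)

falling<max : ∀ j m → All (_< suc (j + m)) (falling j m)
falling<max j m = All.map s≤s (letters≤ (falling↭range j m))

-- Since τ neither begins with its maximum nor increases, it occurs neither at a
-- leading maximum nor within the increasing part.
falling-avoids : ∀ (k : Fin (length τ)) {i i′} → y < lookup τ k →
                 i Fin.< i′ → lookup (y ∷ τ) i′ < lookup (y ∷ τ) i →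
                 ∀ j m → Avoids (falling j m) (y ∷ τ)
falling-avoids k y<τₖ i<i′ τ-descent zero    m =
  avoids-increasing i<i′ τ-descent (range-increasing m)
falling-avoids k y<τₖ i<i′ τ-descent (suc j) m =
  avoids-∷ k y<τₖ (falling<max j m) (falling-avoids k y<τₖ i<i′ τ-descent j m)

-- A permutation ρ ⊕ τ with ρ and τ non-empty begins with a letter at most the length
-- of ρ, hence not with its maximum.
falling-indecomposable : ∀ j m → ¬ Decomposable (falling (suc j) m)
falling-indecomposable j m ([] , _ , _ , _ , ρ≢[] , _ , _)     = ρ≢[] refl
falling-indecomposable j m (_ ∷ _ , [] , _ , _ , _ , τ≢[] , _) = τ≢[] refl
falling-indecomposable j m (x ∷ ρ , y ∷ τ , ρ-perm , _ , _ , _ , eq) =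
  <-irrefl refl (begin-strict
  suc (j + m)                        ≡⟨ proj₁ (∷-injective eq) ⟩
  x                                  ≤⟨ All.head (letters≤ ρ-perm) ⟩
  length (x ∷ ρ)                     <⟨ m<m+n (length (x ∷ ρ)) z<s ⟩
  length (x ∷ ρ) + length (y ∷ τ)
    ≡⟨ cong (length (x ∷ ρ) +_) (length-map (length (x ∷ ρ) +_) (y ∷ τ)) ⟨
  length (x ∷ ρ) + length (map (length (x ∷ ρ) +_) (y ∷ τ))
                                     ≡⟨ length-++ (x ∷ ρ) ⟨
  length ((x ∷ ρ) ⊕ (y ∷ τ))         ≡⟨ cong length eq ⟨
  length (falling (suc j) m)         ≡⟨ length-falling (suc j) m ⟩
  suc (j + m)                        ∎)
  where open ≤-Reasoning

-- Each of the j leading letters is inverted with every letter to its right.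
inversions-falling : ∀ j m → inversions (falling j (suc m)) * 2 ≡ j * (j + suc (m * 2))
inversions-falling zero    m =
  cong (_* 2) (inversions-increasing (range-increasing (suc m)))
inversions-falling (suc j) m = begin
  inversions (falling (suc j) (suc m)) * 2
    ≡⟨ cong (_* 2) (inversions-∷ n (falling j (suc m))) ⟩
  (length (filter (_<? n) (falling j (suc m))) + inversions (falling j (suc m))) * 2
    ≡⟨ cong (λ l → (l + inversions (falling j (suc m))) * 2)
            (trans (cong length (filter-all (_<? n) (falling<max j (suc m))))
                   (length-falling j (suc m))) ⟩
  (j + suc m + inversions (falling j (suc m))) * 2
    ≡⟨ *-distribʳ-+ 2 (j + suc m) (inversions (falling j (suc m))) ⟩
  (j + suc m) * 2 + inversions (falling j (suc m)) * 2
    ≡⟨ cong ((j + suc m) * 2 +_) (inversions-falling j m) ⟩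
  (j + suc m) * 2 + j * (j + suc (m * 2))
    ≡⟨ algebra j m ⟩
  suc j * (suc j + suc (m * 2)) ∎
  where
  open ≡-Reasoning
  n = suc (j + suc m)

  algebra : ∀ j m → (j + suc m) * 2 + j * (j + suc (m * 2)) ≡ suc j * (suc j + suc (m * 2))
  algebra = solve-∀

-- With m ≥ 1 the words are distinct; note falling 1 0 is falling 0 1.
falling-injective : ∀ j m j′ m′ → falling j (suc m) ≡ falling j′ (suc m′) →
                    j ≡ j′ × m ≡ m′
falling-injective zero    m zero     m′ eq = refl , suc-injective (begin
  suc m                     ≡⟨ length-range (suc m) ⟨
  length (range (suc m))    ≡⟨ cong length eq ⟩
  length (range (suc m′))   ≡⟨ length-range (suc m′) ⟩
  suc m′                    ∎)
  where open ≡-Reasoning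
falling-injective zero    m (suc j′) m′ eq =
  contradiction (trans (proj₁ (∷-injective eq)) (cong suc (+-suc j′ m′))) λ ()
falling-injective (suc j) m zero     m′ eq =
  contradiction (trans (sym (proj₁ (∷-injective eq))) (cong suc (+-suc j m))) λ ()
falling-injective (suc j) m (suc j′) m′ eq
  with refl , refl ← falling-injective j m j′ m′ (∷-injectiveʳ eq) = refl , refl

-- Permutations avoiding 132, 213 and 231

-- If the largest letter is not first, then it is last and nothing before it
-- descends.
max-last : ∀ {n} → n ∈ π → All (_≤ n) (x ∷ π) → Unique (x ∷ π) →
  Avoids (x ∷ π) (1 ∷ 3 ∷ 2 ∷ []) → Avoids (x ∷ π) (2 ∷ 1 ∷ 3 ∷ []) →
  Avoids (x ∷ π) (2 ∷ 3 ∷ 1 ∷ []) → AllPairs _<_ (x ∷ π)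
max-last {x = x} {n} n∈π π≤n π! no132 no213 no231 with ∈-∃++ n∈π
... | ρ , [] , refl =
  AllPairs.++⁺ (allPairs⁺ no-descent) ([] ∷ []) (All.tabulate λ y∈ρ → below-max y∈ρ ∷ [])
  where
  below-max : y ∈ x ∷ ρ → y < n
  below-max y∈ρ = ≤∧≢⇒< (All.head (All-resp-⊆ s π≤n)) (allPairs⁻ π! s)
    where s = ++⁺ (from∈ y∈ρ) ⊆-refl

  no-descent : y ∷ z ∷ [] ⊆ x ∷ ρ → y < z
  no-descent {y} {z} s with <-cmp y z
  ... | tri< y<z _ _  = y<z
  ... | tri≈ _ y≡z _  = contradiction y≡z (allPairs⁻ π! (++⁺ s (minimum [ n ])))
  ... | tri> _ _ z<y  = contradiction
    (213⇒contains z<y (below-max (to∈ s)) (++⁺ s ⊆-refl)) no213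
... | ρ , z ∷ ω , refl = contradiction (All-resp-⊆ xnz π≤n) max-interior
  where
  nz : n ∷ z ∷ [] ⊆ ρ ++ n ∷ z ∷ ω
  nz = ++⁺ (minimum ρ) (refl ∷ refl ∷ minimum ω)

  xnz : x ∷ n ∷ z ∷ [] ⊆ x ∷ ρ ++ n ∷ z ∷ ω
  xnz = refl ∷ nz

  max-interior : ¬ All (_≤ n) (x ∷ n ∷ z ∷ [])
  max-interior (x≤n ∷ _ ∷ z≤max ∷ []) with <-cmp x z
  ... | tri< x<z _ _ = no132 (132⇒contains x<z z<n xnz)
    where z<n = ≤∧≢⇒< z≤max (≢-sym (allPairs⁻ π! (x ∷ʳ nz)))
  ... | tri≈ _ x≡z _ = allPairs⁻ π! (refl ∷ ++⁺ (minimum ρ) (n ∷ʳ refl ∷ minimum ω)) x≡z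
  ... | tri> _ _ z<x = no231 (231⇒contains z<x x<n xnz)
    where x<n = ≤∧≢⇒< x≤n (allPairs⁻ π! (refl ∷ ++⁺ (minimum ρ) (refl ∷ minimum (z ∷ ω))))

avoiding⇒falling : ∀ x π → IsPermutation (x ∷ π) →
  Avoids (x ∷ π) (1 ∷ 3 ∷ 2 ∷ []) → Avoids (x ∷ π) (2 ∷ 1 ∷ 3 ∷ []) →
  Avoids (x ∷ π) (2 ∷ 3 ∷ 1 ∷ []) → ∃₂ λ j m → x ∷ π ≡ falling j (suc m)
avoiding⇒falling x π perm no132 no213 no231 with x ≟ suc (length π)
avoiding⇒falling x [] perm no132 no213 no231 | yes refl = 0 , 0 , refl
avoiding⇒falling x (y ∷ π) perm no132 no213 no231 | yes refl =
  let π-perm       = drop-∷ (↭-trans perm (↭-sym (max∷range↭range (length (y ∷ π)))))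
      drop         = x ∷ʳ ⊆-refl
      j , m , π≡   = avoiding⇒falling y π π-perm
                       (avoids-⊆ drop no132) (avoids-⊆ drop no213) (avoids-⊆ drop no231)
      |π|≡j+m      = trans (cong length π≡) (length-falling j (suc m))
  in suc j , m , cong₂ (λ n σ → suc n ∷ σ) |π|≡j+m π≡
avoiding⇒falling x π perm no132 no213 no231 | no x≢max =
  0 , length π , increasing⇒range perm
    (max-last max∈π (letters≤ perm) (letters-unique perm) no132 no213 no231)
  where
  max∈π : suc (length π) ∈ π
  max∈π with ∈-resp-↭ (↭-sym perm) (∈-range⁺ (s≤s z≤n) ≤-refl)
  ... | here max≡x    = contradiction (sym max≡x) x≢max
  ... | there max∈π   = max∈π

-- The patterns 132, 213 and 231.
avoided : List Word
avoided = (1 ∷ 3 ∷ 2 ∷ []) ∷ (2 ∷ 1 ∷ 3 ∷ []) ∷ (2 ∷ 3 ∷ 1 ∷ []) ∷ []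

module _ {k} (1≤k : 1 ≤ k) where

  falling∈I : ∀ j m → j * (j + suc (m * 2)) ≡ k * 2 → I k avoided (falling j (suc m))
  falling∈I zero    m eq =
    contradiction (*-cancelʳ-≡ 0 k 2 eq) (<⇒≢ 1≤k)
  falling∈I (suc j) m eq =
    falling-isPermutation (suc j) (suc m) ,
    ((λ ()) , falling-indecomposable j (suc m)) ,
    *-cancelʳ-≡ _ k 2 (trans (inversions-falling (suc j) m) eq) ,
    -- For each pattern: the position, in the tail, of a letter exceeding the
    -- first one, and then two positions that form a descent.
    avoids zero          {suc zero} {suc (suc zero)} (s≤s (s≤s z≤n)) ≤-refl ≤-refl ∷
    avoids (suc zero)    {zero} {suc zero} ≤-refl z<s ≤-refl ∷
    avoids zero          {suc zero} {suc (suc zero)} ≤-refl ≤-refl (s≤s (s≤s z≤n)) ∷ []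
    where
    avoids : ∀ {τ y} (i : Fin (length τ)) {i₁ i₂} → y < lookup τ i → i₁ Fin.< i₂ →
             lookup (y ∷ τ) i₂ < lookup (y ∷ τ) i₁ → Avoids (falling (suc j) (suc m)) (y ∷ τ)
    avoids i {i₁} {i₂} y<τᵢ i₁<i₂ descent =
      falling-avoids i {i₁} {i₂} y<τᵢ i₁<i₂ descent (suc j) (suc m)

  I⇒falling : I k avoided π →
              ∃₂ λ j m → π ≡ falling j (suc m) × j * (j + suc (m * 2)) ≡ k * 2
  I⇒falling {[]}    (_ , ([]≢[] , _) , _) = contradiction refl []≢[]
  I⇒falling {x ∷ π} (perm , _ , inv , no132 ∷ no213 ∷ no231 ∷ [])
    with j , m , π≡ ← avoiding⇒falling x π perm no132 no213 no231 =
    j , m , π≡ ,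
    trans (sym (inversions-falling j m)) (cong (_* 2) (trans (cong inversions (sym π≡)) inv))

-- Factorisations of 2k and odd divisors of k

halve : ∀ n → (∃[ h ] n ≡ h * 2) ⊎ (∃[ h ] n ≡ suc (h * 2))
halve zero          = inj₁ (0 , refl)
halve (suc zero)    = inj₂ (0 , refl)
halve (suc (suc n)) with halve n
... | inj₁ (h , refl) = inj₁ (suc h , refl)
... | inj₂ (h , refl) = inj₂ (suc h , refl)

odd≢even : ∀ {d e} → ¬ 2 ∣ d → 2 ∣ e → d ≢ e
odd≢even 2∤d 2∣e refl = 2∤d 2∣e

2∤1+even : ∀ h → ¬ 2 ∣ suc (h * 2)
2∤1+even h (divides q eq) =
  even≢odd q h (trans (*-comm 2 q) (trans (sym eq) (cong suc (*-comm h 2))))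

-- The numbers d and e are, in either order, the factors j and j + 2m + 1 of
-- twice the number of inversions of falling j (suc m).
Split : (d e j m : ℕ) → Set
Split d e j m = (d ≡ j × e ≡ j + suc (m * 2)) ⊎ (e ≡ j × d ≡ j + suc (m * 2))

split : ∀ {d e} → ¬ 2 ∣ d → 2 ∣ e → ∃₂ (Split d e)
split {d} 2∤d (divides q refl) with halve d
... | inj₁ (h , d≡h*2) = contradiction (divides h d≡h*2) 2∤d
... | inj₂ (h , refl) with ≤-<-connex q h
...   | inj₁ q≤h with i , refl ← m≤n⇒∃[o]m+o≡n q≤h = q * 2 , i , inj₂ (refl , algebra q i)
  where
  algebra : ∀ q i → suc ((q + i) * 2) ≡ q * 2 + suc (i * 2)
  algebra = solve-∀
...   | inj₂ h<q with i , refl ← m≤n⇒∃[o]m+o≡n h<q = suc (h * 2) , i , inj₁ (refl , algebra h i)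
  where
  algebra : ∀ h i → (suc h + i) * 2 ≡ suc (h * 2) + suc (i * 2)
  algebra = solve-∀

split-product : ∀ {d e j m} → Split d e j m → j * (j + suc (m * 2)) ≡ d * e
split-product         (inj₁ (refl , refl)) = refl
split-product {j = j} (inj₂ (refl , refl)) = *-comm j _

split-⊓ : ∀ {d e j m} → Split d e j m → d ⊓ e ≡ j
split-⊓ {j = j} {m} (inj₁ (refl , refl)) = m≤n⇒m⊓n≡m (m≤m+n j (suc (m * 2)))
split-⊓ {j = j} {m} (inj₂ (refl , refl)) = m≥n⇒m⊓n≡n (m≤m+n j (suc (m * 2)))

split-⌊∣-∣/2⌋ : ∀ {d e j m} → Split d e j m → ⌊ ∣ d - e ∣ /2⌋ ≡ m
split-⌊∣-∣/2⌋ {d} {e} {j} {m} s = trans (cong ⌊_/2⌋ (difference s)) (half m)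
  where
  half : ∀ m → ⌊ suc (m * 2) /2⌋ ≡ m
  half zero    = refl
  half (suc m) = cong suc (half m)

  difference : Split d e j m → ∣ d - e ∣ ≡ suc (m * 2)
  difference (inj₁ (refl , refl)) = ∣m-m+n∣≡n j (suc (m * 2))
  difference (inj₂ (refl , refl)) = trans (∣-∣-comm d e) (∣m-m+n∣≡n j (suc (m * 2)))

-- The odd member of a split pair is determined by its parity.
split-injective : ∀ {d d′ e e′ j m} → ¬ 2 ∣ d → 2 ∣ e → ¬ 2 ∣ d′ → 2 ∣ e′ →
                  Split d e j m → Split d′ e′ j m → d ≡ d′
split-injective _   _   _    _    (inj₁ (d≡ , _)) (inj₁ (d′≡ , _)) = trans d≡ (sym d′≡)
split-injective _   _   _    _    (inj₂ (_ , d≡)) (inj₂ (_ , d′≡)) = trans d≡ (sym d′≡)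
split-injective 2∤d _   _    2∣e′ (inj₁ (d≡ , _)) (inj₂ (e′≡ , _)) =
  contradiction (trans d≡ (sym e′≡)) (odd≢even 2∤d 2∣e′)
split-injective _   2∣e 2∤d′ _    (inj₂ (e≡ , _)) (inj₁ (d′≡ , _)) =
  contradiction (trans d′≡ (sym e≡)) (odd≢even 2∤d′ 2∣e)

-- d is an odd divisor of k.
OddDivisor : ℕ → ℕ → Set
OddDivisor k d = d ∣ k × ¬ 2 ∣ d

-- One of j and j + 2m + 1 is odd; it divides k if their product is 2k.
unsplit : ∀ k j m → j * (j + suc (m * 2)) ≡ k * 2 →
          ∃₂ λ d q → ¬ 2 ∣ d × k ≡ q * d × Split d (q * 2) j m
unsplit k j m eq with halve j
... | inj₁ (h , refl) =
  h * 2 + suc (m * 2) , h ,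
  2∤1+even (h + m) ∘ subst (2 ∣_) (odd h m) ,
  *-cancelʳ-≡ k _ 2 (trans (sym eq) (algebra h (h * 2 + suc (m * 2)))) ,
  inj₂ (refl , refl)
  where
  odd : ∀ h m → h * 2 + suc (m * 2) ≡ suc ((h + m) * 2)
  odd = solve-∀
  algebra : ∀ h d → h * 2 * d ≡ h * d * 2
  algebra = solve-∀
... | inj₂ (h , refl) =
  suc (h * 2) , suc (h + m) ,
  2∤1+even h ,
  *-cancelʳ-≡ k _ 2 (trans (sym eq) (algebra h m)) ,
  inj₁ (refl , even h m)
  where
  even : ∀ h m → suc (h + m) * 2 ≡ suc (h * 2) + suc (m * 2)
  even = solve-∀
  algebra : ∀ h m → suc (h * 2) * (suc (h * 2) + suc (m * 2)) ≡
                    suc (h + m) * suc (h * 2) * 2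
  algebra = solve-∀

-- The even factor 2 (k / d) complementary to an odd divisor d of k; the value
-- at d = 0 is immaterial.
cofactor : ℕ → ℕ → ℕ
cofactor k zero    = 0
cofactor k (suc d) = k / suc d * 2

cofactor-even : ∀ k d → 2 ∣ cofactor k d
cofactor-even k zero    = divides 0 refl
cofactor-even k (suc d) = divides (k / suc d) refl

cofactor-* : ∀ q d → ¬ 2 ∣ d → cofactor (q * d) d ≡ q * 2
cofactor-* q zero    2∤0 = contradiction (divides 0 refl) 2∤0
cofactor-* q (suc d) _   = cong (_* 2) (m*n/n≡m q (suc d))

cofactor-product : ∀ {k d} → OddDivisor k d → d * cofactor k d ≡ k * 2
cofactor-product {d = d} (divides q refl , 2∤d) =
  trans (cong (d *_) (cofactor-* q d 2∤d)) (algebra d q)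
  where
  algebra : ∀ d q → d * (q * 2) ≡ q * d * 2
  algebra = solve-∀

-- The permutation that corresponds to an odd divisor d of k.
-- Its parameters are those of the split of d and 2k / d.
word : ℕ → ℕ → Word
word k d = falling (d ⊓ cofactor k d) (suc ⌊ ∣ d - cofactor k d ∣ /2⌋)

split⇒word : ∀ {k d j m} → Split d (cofactor k d) j m → word k d ≡ falling j (suc m)
split⇒word {m = m} s =
  cong₂ (λ j m → falling j (suc m)) (split-⊓ {m = m} s) (split-⌊∣-∣/2⌋ {m = m} s)

word-injective : ∀ {k d d′} → OddDivisor k d → OddDivisor k d′ →
                 word k d ≡ word k d′ → d ≡ d′
word-injective {k} {d} {d′} (_ , 2∤d) (_ , 2∤d′) eq
  with j , m , s ← split 2∤d (cofactor-even k d)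
     | j′ , m′ , s′ ← split 2∤d′ (cofactor-even k d′)
  with refl , refl ← falling-injective j m j′ m′
                       (trans (sym (split⇒word {m = m} s)) (trans eq (split⇒word {m = m′} s′))) =
  split-injective {m = m} 2∤d (cofactor-even k d) 2∤d′ (cofactor-even k d′) s s′

oddDivisor? : ∀ k → Decidable (OddDivisor k)
oddDivisor? k d = (d ∣? k) ×-dec ¬? (2 ∣? d)

∈-oddDivisors⁺ : ∀ {k d} → 1 ≤ k → OddDivisor k d → d ∈ oddDivisors k
∈-oddDivisors⁺ {k} {d} 1≤k odd@(d∣k , 2∤d) =
  ∈-filter⁺ (oddDivisor? k) (∈-range⁺ 1≤d (∣⇒≤ ⦃ >-nonZero 1≤k ⦄ d∣k)) odd
  where
  1≤d : 1 ≤ d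
  1≤d = n≢0⇒n>0 λ d≡0 → 2∤d (divides 0 d≡0)

∈-oddDivisors⁻ : ∀ {k d} → d ∈ oddDivisors k → OddDivisor k d
∈-oddDivisors⁻ {k} = proj₂ ∘ ∈-filter⁻ (oddDivisor? k) {xs = range k}

theorem22 : (k : ℕ) → 1 ≤ k →
    HasCardinality
    (I k ((1 ∷ 3 ∷ 2 ∷ []) ∷ (2 ∷ 1 ∷ 3 ∷ []) ∷ (2 ∷ 3 ∷ 1 ∷ []) ∷ []))
    (length (oddDivisors k))
theorem22 k 1≤k =
  map (word k) (oddDivisors k) ,
  unique-map word-injective (All.tabulate ∈-oddDivisors⁻)
    (Unique.filter⁺ (oddDivisor? k) (AllPairs.map <⇒≢ (range-increasing k))) ,
  (λ π → mk⇔ sound complete) ,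
  length-map (word k) (oddDivisors k)
  where
  sound : π ∈ map (word k) (oddDivisors k) → I k avoided π
  sound π∈
    with d , d∈ , refl ← ∈-map⁻ (word k) π∈
    with odd@(_ , 2∤d) ← ∈-oddDivisors⁻ {k} d∈
    with j , m , s ← split 2∤d (cofactor-even k d) =
    subst (I k avoided) (sym (split⇒word {m = m} s))
      (falling∈I 1≤k j m (trans (split-product {m = m} s) (cofactor-product odd)))

  complete : I k avoided π → π ∈ map (word k) (oddDivisors k)
  complete π∈I
    with j , m , refl , eq ← I⇒falling 1≤k π∈I
    with d , q , 2∤d , refl , s ← unsplit k j m eq =
    subst (_∈ _) (split⇒word {m = m} (subst (λ e → Split d e j m) (sym (cofactor-* q d 2∤d)) s))
      (∈-map⁺ (word k) (∈-oddDivisors⁺ 1≤k (divides q refl , 2∤d)))
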